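{- Let $\mathsf{CS}$ be an arbitrary constant specification for $\mathsf{JD}$. For each formula $F\in\mathcal{L}_J$, \[ \mathsf{JD}_{\mathsf{CS}}\vdash F \quad\text{if and only if}\quad F \text{ is D-arbitrary } \mathsf{CS}\text{ -valid}. \]
   Context: **Syntax.** Justification terms are built from countably many constants $c_i$ and countably many variables $x_i$ by $t::=c_i\mid x_i\mid t\cdot t\mid (t+t)\mid\, !t$; the set of terms is $\mathsf{Tm}$. Formulas are built from countably many atomic propositions $P_i$ and $\perp$ by $F::=P_i\mid\perp\mid F\to F\mid t:F$; the set of formulas is $\mathcal{L}_J$. The other Boolean connectives are defined as usual from $\to,\perp$; in particular $\neg A:=A\to\perp$ and $\top:=\neg\perp$. **Logic.** The axioms of $\mathsf{JD}$ are (for all terms $s,t$ and formulas $A,B$): (cl) all axioms of classical propositional logic (in the language $\mathcal{L}_J$); (j+) $s:A\lor t:A\to (s+t):A$; (j) $s:(A\to B)\to(t:A\to s\cdot t:B)$; (jd) $\neg(t:\perp)$. A constant specification for $\mathsf{JD}$ is a set $\mathsf{CS}\subseteq\{(c,A)\mid c\text{ a constant and }A\text{ an axiom of }\mathsf{JD}\}$. Write $!^n c$ for $c$ prefixed by $n$ copies of $!$. The logic $\mathsf{JD}_{\mathsf{CS}}$ is given by the axioms of $\mathsf{JD}$ and the rules modus ponens (from $A$ and $A\to B$ infer $B$) and axiom necessitation: for every $(c,A)\in\mathsf{CS}$ and $n\in\mathbb{N}$ (including $n=0$), infer $!^n c:\,!^{n-1}c:\cdots:\,!c:c:A$ (for $n=0$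 this is $c:A$). $\mathsf{JD}_{\mathsf{CS}}\vdash F$ means $F$ is derivable. **Semantics.** A D-arbitrary $\mathsf{CS}$-subset model is $\mathcal{M}=(W,W_0,V,E)$ where $W$ is a set (of worlds), $W_0\subseteq W$, $W_0\neq\emptyset$, and: - $V:W\times\mathcal{L}_J\to\{0,1\}$ is such that for all $\omega\in W_0$, $t\in\mathsf{Tm}$, $F,G\in\mathcal{L}_J$: $V(\omega,\perp)=0$; $V(\omega,F\to G)=1$ iff $V(\omega,F)=0$ or $V(\omega,G)=1$; $V(\omega,t:F)=1$ iff $E(\omega,t)\subseteq[F]$, where $[F]:=\{\upsilon\in W\mid V(\upsilon,F)=1\}$. (No conditions are imposed on $V$ at worlds outside $W_0$.) - $E:W\times\mathsf{Tm}\to\mathcal{P}(W)$ is such that for all $\omega\in W_0$ and $s,t\in\mathsf{Tm}$: (1) $E(\omega,s+t)\subseteq E(\omega,s)\cap E(\omega,t)$; (2) $E(\omega,s\cdot t)\subseteq\{\upsilon\in W\mid \forall F\in\mathsf{APP}_\omega(s,t)\ (\upsilon\in[F])\}$, where $\mathsf{APP}_\omega(s,t):=\{F\in\mathcal{L}_J\mid \exists H\in\mathcal{L}_J \text{ with } E(\omega,s)\subseteq[H\to F]\text{ and }E(\omega,t)\subseteq[H]\}$; (3) there exists $\upsilon\in W_{\not\perp}$ with $\upsilon\in E(\omega,t)$, where $W_{\not\perp}:=\{\upsilon\in W\mid V(\upsilon,\perp)=0\}$; (4) for all $(c,A)\in\mathsf{CS}$: $E(\omega,c)\subseteq[A]$,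 and for all $n\geq 1$, $E(\omega,!^n c)\subseteq[!^{n-1}c:\cdots:\,!c:c:A]$. Truth: $\mathcal{M},\omega\Vdash F$ iff $V(\omega,F)=1$. A formula $F$ is D-arbitrary $\mathsf{CS}$-valid if $\mathcal{M},\omega\Vdash F$ for every D-arbitrary $\mathsf{CS}$-subset model $\mathcal{M}=(W,W_0,V,E)$ and every $\omega\in W_0$. -}

module Defs where

open import Data.Bool.Base using (Bool; true; false)
open import Data.Nat.Base using (ℕ; zero; suc)
open import Data.Product.Base using (∃; ∃-syntax; _×_)
open import Data.Sum.Base using (_⊎_)
open import Function.Bundles using (_⇔_)
open import Level using (Level; 0ℓ) renaming (suc to lsuc)
open import Relation.Binary.Core using (REL)
open import Relation.Binary.PropositionalEquality.Core using (_≡_)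
open import Relation.Unary using (Pred; _∈_; _⊆_; _∩_)

infix  9 !_
infixl 8 _·_
infixl 7 _⊕_
infixr 6 _∶_
infix  5 ¬_
infixr 4 _∨_
infixr 3 _⇒_
infix  2 _⊢_

data Term : Set where
  con : ℕ → Term
  var : ℕ → Term
  _·_ : Term → Term → Term
  _⊕_ : Term → Term → Term
  !_  : Term → Term

data Formula : Set where
  atom : ℕ → Formula
  ⊥    : Formula
  _⇒_  : Formula → Formula → Formula
  _∶_  : Term → Formula → Formula

¬_ : Formula → Formula
¬ A = A ⇒ ⊥

_∨_ : Formula → Formula → Formula
A ∨ B = ¬ A ⇒ B

-- The first three schemes are a standard Hilbert axiomatisation, with modus
-- ponens, of classical propositional logic over ⇒ and ⊥.
data Axiom : Pred Formula 0ℓ where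
  cl-K   : ∀ A B → Axiom (A ⇒ B ⇒ A)
  cl-S   : ∀ A B C → Axiom ((A ⇒ B ⇒ C) ⇒ (A ⇒ B) ⇒ A ⇒ C)
  cl-DNE : ∀ A → Axiom (¬ ¬ A ⇒ A)
  j+     : ∀ s t A → Axiom ((s ∶ A) ∨ (t ∶ A) ⇒ (s ⊕ t) ∶ A)
  j      : ∀ s t A B → Axiom (s ∶ (A ⇒ B) ⇒ t ∶ A ⇒ (s · t) ∶ B)
  jd     : ∀ t → Axiom (¬ (t ∶ ⊥))

-- The index i stands for the constant con i.
record ConstantSpec (ℓ : Level) : Set (lsuc ℓ) where
  field
    Spec    : REL ℕ Formula ℓ
    isAxiom : ∀ {i A} → Spec i A → Axiom A

!^ : ℕ → Term → Term
!^ zero    t = t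
!^ (suc n) t = ! (!^ n t)

-- !ⁿc : !ⁿ⁻¹c : ⋯ : !c : c : A
tower : ℕ → Term → Formula → Formula
tower zero    c A = c ∶ A
tower (suc n) c A = !^ (suc n) c ∶ tower n c A

data _⊢_ {ℓ : Level} (CS : ConstantSpec ℓ) : Pred Formula ℓ where
  ax : ∀ {A} → Axiom A → CS ⊢ A
  mp : ∀ {A B} → CS ⊢ A → CS ⊢ A ⇒ B → CS ⊢ B
  an : ∀ {i A} (n : ℕ) → ConstantSpec.Spec CS i A → CS ⊢ tower n (con i) A

module _ {ℓ : Level} (CS : ConstantSpec ℓ) where
  open ConstantSpec CS

  record SubsetModel : Set (lsuc ℓ) where
    field
      W  : Set ℓ
      W₀ : Pred W ℓ
      V  : W → Formula → Bool
      E  : W → Term → Pred W ℓ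

    [_] : Formula → Pred W 0ℓ
    [ F ] υ = V υ F ≡ true

    W-¬⊥ : Pred W 0ℓ
    W-¬⊥ υ = V υ ⊥ ≡ false

    APP : W → Term → Term → Pred Formula ℓ
    APP ω s t F = ∃[ H ] (E ω s ⊆ [ H ⇒ F ]) × (E ω t ⊆ [ H ])

    field
      W₀-nonempty : ∃ W₀

      V-⊥ : ∀ {ω} → ω ∈ W₀ → V ω ⊥ ≡ false
      V-⇒ : ∀ {ω} → ω ∈ W₀ → ∀ F G →
            (V ω (F ⇒ G) ≡ true) ⇔ (V ω F ≡ false ⊎ V ω G ≡ true)
      V-∶ : ∀ {ω} → ω ∈ W₀ → ∀ t F →
            (V ω (t ∶ F) ≡ true) ⇔ (E ω t ⊆ [ F ])

      E-⊕ : ∀ {ω} → ω ∈ W₀ → ∀ s t → E ω (s ⊕ t) ⊆ E ω s ∩ E ω t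
      E-· : ∀ {ω} → ω ∈ W₀ → ∀ s t →
            E ω (s · t) ⊆ λ υ → ∀ F → F ∈ APP ω s t → υ ∈ [ F ]
      E-D : ∀ {ω} → ω ∈ W₀ → ∀ t → ∃[ υ ] υ ∈ W-¬⊥ × υ ∈ E ω t
      E-c : ∀ {ω} → ω ∈ W₀ → ∀ {i A} → Spec i A → E ω (con i) ⊆ [ A ]
      E-! : ∀ {ω} → ω ∈ W₀ → ∀ {i A} → Spec i A → ∀ n →
            E ω (!^ (suc n) (con i)) ⊆ [ tower n (con i) A ]

    infix 2 _⊩_
    _⊩_ : W → Pred Formula 0ℓ
    ω ⊩ F = V ω F ≡ true

  Valid : Pred Formula (lsuc ℓ)
  Valid F = (M : SubsetModel) → let open SubsetModel M in
            ∀ ω → ω ∈ W₀ → ω ⊩ F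

{-# OPTIONS --safe #-}
-- Completeness: the worlds of the canonical model are all Boolean valuations
-- of formulas, and the normal worlds W₀ are those that respect ⊥ and ⇒ and
-- verify every theorem.  A valuation u lies in E v t when u verifies every A
-- with v (t ∶ A) = true; the valuation A ↦ v (t ∶ A) is itself such a world,
-- which yields the truth condition for t ∶ A and condition (3).
--
-- A normal world refuting an unprovable F comes from a Lindenbaum construction
-- whose state is a single unprovable formula G, starting from F.  When A is
-- processed, G is kept if A ⇒ G is provable and replaced by A ⇒ G otherwise,
-- so that afterwards one of A ⇒ G and ¬ A ⇒ G is provable.  Both cannot be, as
-- G is unprovable; A is declared false in the first case, true in the second.
module Submission where

open import Defs
open import Axiom.ExcludedMiddle using (ExcludedMiddle)
open import Data.Bool.Base using (Bool; true; false)
open import Data.Bool.Properties using (¬-not)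
open import Data.List.Base
  using (List; []; _∷_; _++_; map; foldr; upTo; cartesianProductWith)
open import Data.List.Membership.Propositional using () renaming (_∈_ to _∈ˡ_)
open import Data.List.Membership.Propositional.Properties
  using (∈-map⁺; ∈-++⁺ˡ; ∈-++⁺ʳ; ∈-upTo⁺; ∈-cartesianProductWith⁺)
open import Data.List.Relation.Unary.Any using (here; there)
open import Data.Nat.Base using (ℕ; zero; suc; _≤_; _⊔_; s≤s; _≤′_; ≤′-refl; ≤′-step)
open import Data.Nat.Properties
  using (≤-refl; m⊔n≤o⇒m≤o; m⊔n≤o⇒n≤o; m≤m⊔n; m≤n⊔m; ≤⇒≤′)
open import Data.Product.Base using (∃-syntax; _×_; _,_)
open import Data.Sum.Base using (_⊎_; inj₁; inj₂; [_,_]′)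
open import Function.Base using (_∘_; const)
open import Function.Bundles using (_⇔_; mk⇔; module Equivalence)
open import Level using (Level; Lift; lift; lower)
open import Relation.Binary.PropositionalEquality.Core
  using (_≡_; refl)
open import Relation.Nullary.Decidable.Core using (yes; no)
open import Relation.Nullary.Negation.Core using (contradiction) renaming (¬_ to Not)
open import Relation.Unary using (Pred; _∈_)

open Equivalence using (to; from)

private variable
  ℓ : Level
  CS : ConstantSpec ℓ
  A B C F G : Formula

true≢false : ∀ {b} → b ≡ true → Not (b ≡ false)
true≢false refl ()

-- Soundness

module _ {CS : ConstantSpec ℓ} (M : SubsetModel CS) where
  open SubsetModel M

  module _ {ω : W} (ω∈W₀ : ω ∈ W₀) where

    -- `V` is Boolean, so a case split on `V ω F` turns an Agda implication into truth of `F ⇒ G`.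
    -- With `⊩-elim`, axioms are then checked as in natural deduction.
    ⊩-intro : ∀ F G → (ω ⊩ F → ω ⊩ G) → ω ⊩ F ⇒ G
    ⊩-intro F G f with V ω F in eq
    ... | true  = from (V-⇒ ω∈W₀ F G) (inj₂ (f refl))
    ... | false = from (V-⇒ ω∈W₀ F G) (inj₁ eq)

    ⊩-elim : ∀ F G → ω ⊩ F ⇒ G → ω ⊩ F → ω ⊩ G
    ⊩-elim F G p q with to (V-⇒ ω∈W₀ F G) p
    ... | inj₁ r = contradiction r (true≢false q)
    ... | inj₂ r = r

    ⊮⊥ : Not (ω ⊩ ⊥)
    ⊮⊥ p = true≢false p (V-⊥ ω∈W₀)

    ⊩-axiom : Axiom F → ω ⊩ F
    ⊩-axiom (cl-K A B) = ⊩-intro A (B ⇒ A) λ a → ⊩-intro B A λ _ → a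
    ⊩-axiom (cl-S A B C) =
      ⊩-intro (A ⇒ B ⇒ C) ((A ⇒ B) ⇒ A ⇒ C) λ f →
      ⊩-intro (A ⇒ B) (A ⇒ C) λ g →
      ⊩-intro A C λ a →
      ⊩-elim B C (⊩-elim A (B ⇒ C) f a) (⊩-elim A B g a)
    ⊩-axiom (cl-DNE A) = ⊩-intro (¬ ¬ A) A λ f → ¬-not λ a≡false →
      ⊮⊥ (⊩-elim (¬ A) ⊥ f (from (V-⇒ ω∈W₀ A ⊥) (inj₁ a≡false)))
    ⊩-axiom (j+ s t A) = ⊩-intro ((s ∶ A) ∨ (t ∶ A)) ((s ⊕ t) ∶ A) λ f →
      from (V-∶ ω∈W₀ (s ⊕ t) A) λ e → either f (E-⊕ ω∈W₀ s t e)
      where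
      either : ∀ {υ} → ω ⊩ (s ∶ A) ∨ (t ∶ A) → E ω s υ × E ω t υ → υ ⊩ A
      -- The disjunction abbreviates `¬ (s ∶ A) ⇒ t ∶ A`, so the value of `s ∶ A` picks the disjunct
      -- to use.
      either f (eₛ , eₜ) with V ω (s ∶ A) in eq
      ... | true  = to (V-∶ ω∈W₀ s A) eq eₛ
      ... | false = to (V-∶ ω∈W₀ t A)
        (⊩-elim (¬ (s ∶ A)) (t ∶ A) f (from (V-⇒ ω∈W₀ (s ∶ A) ⊥) (inj₁ eq))) eₜ
    ⊩-axiom (j s t A B) =
      ⊩-intro (s ∶ (A ⇒ B)) (t ∶ A ⇒ (s · t) ∶ B) λ p →
      ⊩-intro (t ∶ A) ((s · t) ∶ B) λ q →
      from (V-∶ ω∈W₀ (s · t) B) λ e →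
      E-· ω∈W₀ s t e B (A , to (V-∶ ω∈W₀ s (A ⇒ B)) p , to (V-∶ ω∈W₀ t A) q)
    ⊩-axiom (jd t) = ⊩-intro (t ∶ ⊥) ⊥ λ p →
      let υ , υ⊮⊥ , e = E-D ω∈W₀ t in
      contradiction υ⊮⊥ (true≢false (to (V-∶ ω∈W₀ t ⊥) p e))

    soundness : CS ⊢ F → ω ⊩ F
    soundness (ax a) = ⊩-axiom a
    soundness (mp {A} {B} d e) = ⊩-elim A B (soundness e) (soundness d)
    soundness (an {i} {A} zero c) = from (V-∶ ω∈W₀ (con i) A) (E-c ω∈W₀ c)
    soundness (an {i} {A} (suc n) c) =
      from (V-∶ ω∈W₀ (!^ (suc n) (con i)) (tower n (con i) A)) (E-! ω∈W₀ c n)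

-- Propositional reasoning in JD

weaken : CS ⊢ B → CS ⊢ A ⇒ B
weaken d = mp d (ax (cl-K _ _))

ap : CS ⊢ A ⇒ B ⇒ C → CS ⊢ A ⇒ B → CS ⊢ A ⇒ C
ap d e = mp e (mp d (ax (cl-S _ _ _)))

⇒-refl : CS ⊢ A ⇒ A
⇒-refl {A = A} = ap (ax (cl-K A (A ⇒ A))) (ax (cl-K A A))

⇒-trans : CS ⊢ A ⇒ B → CS ⊢ B ⇒ C → CS ⊢ A ⇒ C
⇒-trans d e = ap (weaken e) d

ex-falso : CS ⊢ ⊥ ⇒ A
ex-falso = ⇒-trans (ax (cl-K _ _)) (ax (cl-DNE _))

⇒-monoʳ : CS ⊢ B ⇒ C → CS ⊢ (A ⇒ B) ⇒ A ⇒ C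
⇒-monoʳ d = mp (weaken d) (ax (cl-S _ _ _))

¬-⇒ : CS ⊢ ¬ A ⇒ A ⇒ B
¬-⇒ = ⇒-monoʳ ex-falso

-- Contraposing the first premise and composing with the second gives `¬ B ⇒ B`; combined with
-- `¬ B ⇒ ¬ B` this is `¬ ¬ B`.
by-cases : CS ⊢ A ⇒ B → CS ⊢ ¬ A ⇒ B → CS ⊢ B
by-cases {A = A} {B = B} d e =
  mp (ap ⇒-refl (⇒-trans contrapositive e)) (ax (cl-DNE B))
  where
  contrapositive = ap (⇒-trans (ax (cl-K _ A)) (ax (cl-S _ _ _))) (weaken d)

-- Cases on `A`: if it holds, `A ⇒ B` yields `B` and hence `C`; otherwise `C` follows from `¬ A`.
⇒-by-cases : CS ⊢ ¬ A ⇒ C → CS ⊢ B ⇒ C → CS ⊢ (A ⇒ B) ⇒ C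
⇒-by-cases d e = by-cases
  (⇒-trans (ax (cl-K _ _)) (⇒-trans (mp ⇒-refl (ax (cl-S _ _ _))) (⇒-monoʳ e)))
  (⇒-trans d (ax (cl-K _ _)))

-- Enumeration of formulas

-- Level `suc n` of the lists takes indices from `upTo n`, that is `i < n`; hence the rank `i + 2`
-- of constants, variables and atoms.
rankᵗ : Term → ℕ
rankᵗ (con i) = suc (suc i)
rankᵗ (var i) = suc (suc i)
rankᵗ (s · t) = suc (rankᵗ s ⊔ rankᵗ t)
rankᵗ (s ⊕ t) = suc (rankᵗ s ⊔ rankᵗ t)
rankᵗ (! t)   = suc (rankᵗ t)

rank : Formula → ℕ
rank (atom i) = suc (suc i)
rank ⊥        = 1
rank (F ⇒ G)  = suc (rank F ⊔ rank G)
rank (t ∶ F)  = suc (rankᵗ t ⊔ rank F)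

terms : ℕ → List Term
terms zero    = []
terms (suc n) =
  map con (upTo n) ++ map var (upTo n) ++ map !_ (terms n) ++
  cartesianProductWith _·_ (terms n) (terms n) ++
  cartesianProductWith _⊕_ (terms n) (terms n)

formulas : ℕ → List Formula
formulas zero    = []
formulas (suc n) =
  ⊥ ∷ map atom (upTo n) ++
  cartesianProductWith _⇒_ (formulas n) (formulas n) ++
  cartesianProductWith _∶_ (terms n) (formulas n)

∈-terms : ∀ t {n} → rankᵗ t ≤ n → t ∈ˡ terms n
∈-terms (con i) (s≤s p) = ∈-++⁺ˡ (∈-map⁺ con (∈-upTo⁺ p))
∈-terms (var i) {suc n} (s≤s p) =
  ∈-++⁺ʳ (map con (upTo n)) (∈-++⁺ˡ (∈-map⁺ var (∈-upTo⁺ p)))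
∈-terms (! t) {suc n} (s≤s p) =
  ∈-++⁺ʳ (map con (upTo n)) (∈-++⁺ʳ (map var (upTo n))
    (∈-++⁺ˡ (∈-map⁺ !_ (∈-terms t p))))
∈-terms (s · t) {suc n} (s≤s p) =
  ∈-++⁺ʳ (map con (upTo n)) (∈-++⁺ʳ (map var (upTo n))
    (∈-++⁺ʳ (map !_ (terms n)) (∈-++⁺ˡ
      (∈-cartesianProductWith⁺ _·_ (∈-terms s (m⊔n≤o⇒m≤o _ _ p))
                                   (∈-terms t (m⊔n≤o⇒n≤o _ _ p))))))
∈-terms (s ⊕ t) {suc n} (s≤s p) =
  ∈-++⁺ʳ (map con (upTo n)) (∈-++⁺ʳ (map var (upTo n))
    (∈-++⁺ʳ (map !_ (terms n))
      (∈-++⁺ʳ (cartesianProductWith _·_ (terms n) (terms n))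
        (∈-cartesianProductWith⁺ _⊕_ (∈-terms s (m⊔n≤o⇒m≤o _ _ p))
                                     (∈-terms t (m⊔n≤o⇒n≤o _ _ p))))))

∈-formulas : ∀ F {n} → rank F ≤ n → F ∈ˡ formulas n
∈-formulas ⊥ (s≤s p) = here refl
∈-formulas (atom i) (s≤s p) = there (∈-++⁺ˡ (∈-map⁺ atom (∈-upTo⁺ p)))
∈-formulas (F ⇒ G) {suc n} (s≤s p) =
  there (∈-++⁺ʳ (map atom (upTo n)) (∈-++⁺ˡ
    (∈-cartesianProductWith⁺ _⇒_ (∈-formulas F (m⊔n≤o⇒m≤o _ _ p))
                                 (∈-formulas G (m⊔n≤o⇒n≤o _ _ p)))))
∈-formulas (t ∶ F) {suc n} (s≤s p) =
  there (∈-++⁺ʳ (map atom (upTo n))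
    (∈-++⁺ʳ (cartesianProductWith _⇒_ (formulas n) (formulas n))
      (∈-cartesianProductWith⁺ _∶_ (∈-terms t (m⊔n≤o⇒m≤o _ _ p))
                                   (∈-formulas F (m⊔n≤o⇒n≤o _ _ p)))))

-- The canonical model

record Normal (CS : ConstantSpec ℓ) (v : Formula → Bool) : Set ℓ where
  field
    ⊥-false      : v ⊥ ≡ false
    ⇒-true       : ∀ F G → (v (F ⇒ G) ≡ true) ⇔ (v F ≡ false ⊎ v G ≡ true)
    theorem-true : CS ⊢ F → v F ≡ true

  ⇒-elim : v (F ⇒ G) ≡ true → v F ≡ true → v G ≡ true
  ⇒-elim p q with to (⇒-true _ _) p
  ... | inj₁ r = contradiction r (true≢false q)
  ... | inj₂ r = r

  axiom-elim : Axiom (F ⇒ G) → v F ≡ true → v G ≡ true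
  axiom-elim a = ⇒-elim (theorem-true (ax a))

canonical : ∀ {CS : ConstantSpec ℓ} {v} → Normal CS v → SubsetModel CS
canonical {ℓ} {CS} {v₀} normal₀ = record
  { W = Lift ℓ (Formula → Bool)
  ; W₀ = λ v → Normal CS (lower v)
  ; V = lower
  ; E = E
  ; W₀-nonempty = lift v₀ , normal₀
  ; V-⊥ = ⊥-false
  ; V-⇒ = ⇒-true
  ; V-∶ = λ {v} _ t F → mk⇔ (λ { p (lift e) → e p }) (∶-true v t)
  ; E-⊕ = λ v∈ s t (lift e) →
      lift (λ {A} p → e (axiom-elim v∈ (j+ s t A) (from (⇒-true v∈ _ _)
        (inj₁ (¬-false v∈ p))))) ,
      lift (λ {A} p → e (axiom-elim v∈ (j+ s t A) (from (⇒-true v∈ _ _) (inj₂ p))))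
  -- `∶-true` turns the two inclusions in `APP` back into truth of `s ∶ (H ⇒ F)` and `t ∶ H`, so
  -- that `j` applies.
  ; E-· = λ {v} v∈ s t (lift e) F (H , p , q) → e (⇒-elim v∈
      (axiom-elim v∈ (j s t H F) (∶-true v s p)) (∶-true v t q))
  ; E-D = λ {v} v∈ t → lift (lower v ∘ (t ∶_)) , ∶⊥-false v∈ , lift λ p → p
  ; E-c = λ v∈ c (lift e) → e (theorem-true v∈ (an 0 c))
  ; E-! = λ v∈ c n (lift e) → e (theorem-true v∈ (an (suc n) c))
  }
  where
  open Normal

  E : Lift ℓ (Formula → Bool) → Term → Pred (Lift ℓ (Formula → Bool)) ℓ
  E (lift v) t (lift u) = Lift ℓ (∀ {A} → v (t ∶ A) ≡ true → u A ≡ true)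

  ∶-true : ∀ v t {F} → (∀ {u} → E v t u → lower u F ≡ true) → lower v (t ∶ F) ≡ true
  ∶-true (lift v) t f = f {lift (v ∘ (t ∶_))} (lift λ p → p)

  ¬-false : ∀ {v} → Normal CS v → v A ≡ true → v (¬ A) ≡ false
  ¬-false n p = ¬-not λ q → true≢false (⇒-elim n q p) (⊥-false n)

  ∶⊥-false : ∀ {v t} → Normal CS v → v (t ∶ ⊥) ≡ false
  ∶⊥-false {t = t} n = ¬-not λ p → true≢false (axiom-elim n (jd t) p) (⊥-false n)

-- The Lindenbaum construction

module Lindenbaum (em : ExcludedMiddle ℓ) (CS : ConstantSpec ℓ)
                  {F₀ : Formula} (⊬F₀ : Not (CS ⊢ F₀)) where

  Decided : Formula → Formula → Set ℓ
  Decided G A = (CS ⊢ A ⇒ G) ⊎ (CS ⊢ ¬ A ⇒ G)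

  step : Formula → Formula → Formula
  step A G with em {CS ⊢ A ⇒ G}
  ... | yes _ = G
  ... | no  _ = A ⇒ G

  step-⇒ : ∀ A G → CS ⊢ G ⇒ step A G
  step-⇒ A G with em {CS ⊢ A ⇒ G}
  ... | yes _ = ⇒-refl
  ... | no  _ = ax (cl-K G A)

  step-unprovable : ∀ A G → Not (CS ⊢ G) → Not (CS ⊢ step A G)
  step-unprovable A G with em {CS ⊢ A ⇒ G}
  ... | yes _  = λ ⊬G → ⊬G
  ... | no  ⊬  = λ _ → ⊬

  step-decided : ∀ A G → Decided (step A G) A
  step-decided A G with em {CS ⊢ A ⇒ G}
  ... | yes d = inj₁ d
  ... | no  _ = inj₂ ¬-⇒

  decided-mono : CS ⊢ F ⇒ G → Decided F A → Decided G A
  decided-mono d (inj₁ e) = inj₁ (⇒-trans e d)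
  decided-mono d (inj₂ e) = inj₂ (⇒-trans e d)

  foldr-⇒ : ∀ As G → CS ⊢ G ⇒ foldr step G As
  foldr-⇒ []       G = ⇒-refl
  foldr-⇒ (A ∷ As) G = ⇒-trans (foldr-⇒ As G) (step-⇒ A _)

  foldr-unprovable : ∀ As G → Not (CS ⊢ G) → Not (CS ⊢ foldr step G As)
  foldr-unprovable []       G ⊬G = ⊬G
  foldr-unprovable (A ∷ As) G ⊬G = step-unprovable A _ (foldr-unprovable As G ⊬G)

  foldr-decided : ∀ As G → A ∈ˡ As → Decided (foldr step G As) A
  foldr-decided (A ∷ As) G (here refl) = step-decided A _
  foldr-decided (A ∷ As) G (there p)   =
    decided-mono (step-⇒ A _) (foldr-decided As G p)

  -- Each stage treats a whole finite list, so the lists stand in for a numbering of formulas.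
  -- Treating a formula again is harmless by `decided-mono`.
  stage : ℕ → Formula
  stage zero    = F₀
  stage (suc n) = foldr step (stage n) (formulas n)

  stage-unprovable : ∀ n → Not (CS ⊢ stage n)
  stage-unprovable zero    = ⊬F₀
  stage-unprovable (suc n) = foldr-unprovable (formulas n) _ (stage-unprovable n)

  stage-mono : ∀ {m n} → m ≤′ n → CS ⊢ stage m ⇒ stage n
  stage-mono ≤′-refl             = ⇒-refl
  stage-mono (≤′-step {n = n} p) = ⇒-trans (stage-mono p) (foldr-⇒ (formulas n) _)

  decided : ∀ A → Decided (stage (suc (rank A))) A
  -- `formulas n` is processed in passing from `stage n` to `stage (suc n)`, hence the successor of
  -- the rank.
  decided A = foldr-decided (formulas (rank A)) _ (∈-formulas A ≤-refl)

  valuation : Formula → Bool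
  valuation A = [ const false , const true ]′ (decided A)

  -- Classically, `A ⇒ stage n` says that `¬ stage n` refutes `A`. The formulas `¬ stage n` grow
  -- stronger with `n`, and their joint consequences form the maximal consistent set behind
  -- `valuation`.
  Excluded : Formula → Set ℓ
  Excluded A = ∃[ n ] (CS ⊢ A ⇒ stage n)

  excluded-⇒ : CS ⊢ A ⇒ B → Excluded B → Excluded A
  excluded-⇒ d (n , e) = n , ⇒-trans d e

  common-stage : Excluded A → Excluded B →
                 ∃[ n ] (CS ⊢ A ⇒ stage n) × (CS ⊢ B ⇒ stage n)
  common-stage (m , d) (n , e) =
    m ⊔ n , ⇒-trans d (stage-mono (≤⇒≤′ (m≤m⊔n m n)))
          , ⇒-trans e (stage-mono (≤⇒≤′ (m≤n⊔m m n)))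

  -- At a common stage, `by-cases` would prove the stage itself.
  excluded-consistent : Excluded A → Not (Excluded (¬ A))
  excluded-consistent p q =
    let n , d , e = common-stage p q in stage-unprovable n (by-cases d e)

  theorem-not-excluded : CS ⊢ A → Not (Excluded A)
  theorem-not-excluded d (n , e) = stage-unprovable n (mp d e)

  excluded-implication : Excluded (¬ A) → Excluded B → Excluded (A ⇒ B)
  excluded-implication p q =
    let n , d , e = common-stage p q in n , ⇒-by-cases d e

  false⇒excluded : ∀ A → valuation A ≡ false → Excluded A
  false⇒excluded A p with decided A | p
  ... | inj₁ d | _  = suc (rank A) , d
  ... | inj₂ _ | ()

  true⇒excluded-¬ : ∀ A → valuation A ≡ true → Excluded (¬ A)
  true⇒excluded-¬ A p with decided A | p
  ... | inj₁ _ | ()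
  ... | inj₂ d | _  = suc (rank A) , d

  -- `decided` merely picks one side of a sum; consistency rules out the other, so `valuation` is
  -- governed by `Excluded` and not by the stage at which `A` was decided.
  excluded⇒false : Excluded A → valuation A ≡ false
  excluded⇒false p = ¬-not λ q → excluded-consistent p (true⇒excluded-¬ _ q)

  not-excluded⇒true : Not (Excluded A) → valuation A ≡ true
  not-excluded⇒true ⊬ = ¬-not λ p → ⊬ (false⇒excluded _ p)

  valuation-normal : Normal CS valuation
  valuation-normal = record
    { ⊥-false      = excluded⇒false (0 , ex-falso)
    ; ⇒-true       = λ F G → mk⇔ (split F G) (join F G)
    ; theorem-true = not-excluded⇒true ∘ theorem-not-excluded
    }
    where
    split : ∀ F G → valuation (F ⇒ G) ≡ true → valuation F ≡ false ⊎ valuation G ≡ true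
    split F G p with valuation F in eq
    ... | false = inj₁ refl
    -- If `G` were excluded, so would be `F ⇒ G`, since `¬ F` is; but `p` excludes `¬ (F ⇒ G)`.
    ... | true  = inj₂ (not-excluded⇒true λ q → excluded-consistent
      (excluded-implication (true⇒excluded-¬ F eq) q) (true⇒excluded-¬ (F ⇒ G) p))

    join : ∀ F G → valuation F ≡ false ⊎ valuation G ≡ true → valuation (F ⇒ G) ≡ true
    join F G (inj₁ p) = not-excluded⇒true λ q →
      excluded-consistent (false⇒excluded F p) (excluded-⇒ ¬-⇒ q)
    join F G (inj₂ p) = not-excluded⇒true λ q →
      excluded-consistent (excluded-⇒ (ax (cl-K G F)) q) (true⇒excluded-¬ G p)

  valuation-F₀ : valuation F₀ ≡ false
  valuation-F₀ = excluded⇒false (0 , ⇒-refl)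

-- Completeness and the equivalence

completeness : ExcludedMiddle ℓ → (CS : ConstantSpec ℓ) (F : Formula) →
               Valid CS F → CS ⊢ F
completeness em CS F valid with em {CS ⊢ F}
... | yes d = d
-- The countermodel is the canonical model, evaluated at the Lindenbaum valuation itself, where `F`
-- is false.
... | no ⊬F = contradiction valuation-F₀
  (true≢false (valid (canonical valuation-normal) (lift valuation) valuation-normal))
  where open Lindenbaum em CS ⊬F

theorem10 : ∀ {ℓ} → ExcludedMiddle ℓ → (CS : ConstantSpec ℓ) (F : Formula) → (CS ⊢ F) ⇔ Valid CS F
theorem10 em CS F = mk⇔ (λ d M ω ω∈W₀ → soundness M ω∈W₀ d) (completeness em CS F)
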